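{- Let $p$ be a prime number and let $x,y,z\in\mathbb{N}$ (positive integers) with $x\le y\le z$ satisfy $$\frac{4}{p}=\frac{1}{x}+\frac{1}{y}+\frac{1}{z}.$$ Then $$4xy-(x+y)p=\gcd(y,p)\,\gcd(xy,\,x+y).$$
   Context: $\mathbb{N}$ denotes the positive integers. -}

module Defs where

{-# OPTIONS --safe #-}

-- Put g = gcd(xy, x+y), xy = ag, x+y = bg, so that gcd(a,b) = 1 and the equation reads
-- (4a - pb) z = pa.  It remains to show that e = 4a - pb equals gcd(y,p).  Since 4/p > 3/p,
-- x < p; hence p divides a exactly when it divides y.
-- If p does not divide a, then e is coprime to a, so e divides p; and e = p would force p = 2,
-- x = 1, y = z = 2.  If a = pa', then e = pf with f = 4a' - b coprime to a' and fz = pa', so f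
-- divides p; and f = p would give z = a' and xy = pgz, whence x ≥ p.

module Submission where

open import Defs
open import Data.Nat.Base as ℕ using (ℕ; NonZero)
open import Data.Nat.GCD using (gcd)
open import Data.Nat.Primality using (Prime; prime⇒nonZero)
open import Data.Integer.Base as ℤ using (+_)
open import Data.Rational.Base as ℚ using (_/_)
open import Relation.Binary.PropositionalEquality using (_≡_)

open import Data.Nat.Base using (suc; _+_; _*_; _∸_; _≤_; _<_; z≤n; s≤s; s≤s⁻¹; ≢-nonZero; ≢-nonZero⁻¹)
open import Data.Nat.Properties
open import Data.Nat.Divisibility
open import Data.Nat.DivMod using (m/n*n≡m) renaming (_/_ to _/ₙ_)
open import Data.Nat.GCD using (gcd[m,n]∣m; gcd[m,n]∣n; gcd[m,n]≢0; gcd-greatest)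
open import Data.Nat.Coprimality as Coprime using (Coprime; coprime-/gcd; coprime-divisor; coprime⇒gcd≡1)
open import Data.Nat.Primality using (euclidsLemma; prime⇒irreducible; prime⇒nonTrivial; irreducible[2])
open import Data.Nat.Tactic.RingSolver using (solve; solve-∀)
open import Data.List.Base using (_∷_; [])
import Data.Integer.Properties as ℤ
import Data.Rational.Properties as ℚ
import Data.Rational.Unnormalised.Base as ℚᵘ
import Data.Rational.Unnormalised.Properties as ℚᵘ
open import Data.Product.Base using (∃; _×_; _,_; proj₁; proj₂)
open import Data.Sum.Base using (inj₁; inj₂; [_,_]′)
open import Relation.Nullary using (¬_; yes; no; contradiction)
open import Relation.Binary.PropositionalEquality using (refl; sym; trans; cong; cong₂; subst; module ≡-Reasoning)

-- Coprimality, subtraction and size bounds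

∤⇒coprime : ∀ {p n} → Prime p → p ∤ n → Coprime p n
∤⇒coprime pp p∤n (d∣p , d∣n) with prime⇒irreducible pp d∣p
... | inj₁ d≡1 = d≡1
... | inj₂ refl = contradiction d∣n p∤n

-- A common divisor `d` of `e` and `a` divides `q * b`. Dividing `a`, it is coprime to `q`, so it
-- divides `b` and must be 1. The factor `q` is `p` when `p` does not divide `a`, and 1 once `p` has
-- been cancelled.
coprime-remainder : ∀ k {a b q e} → Coprime q a → Coprime b a →
                    k * a ≡ q * b + e → Coprime e a
coprime-remainder k {a} {b} {q} q⊥a b⊥a ka≡qb+e {d} (d∣e , d∣a) = b⊥a (d∣b , d∣a)
  where
  d∣qb : d ∣ q * b
  d∣qb = ∣m+n∣m⇒∣n (subst (d ∣_) (trans ka≡qb+e (+-comm (q * b) _)) (∣n⇒∣m*n k d∣a)) d∣e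
  d∣b : d ∣ b
  d∣b = coprime-divisor (λ { (c∣d , c∣q) → q⊥a (c∣q , ∣-trans c∣d d∣a) }) d∣qb

-- Cancelling the nonzero `z` in `B * z ≤ A * z` gives `B ≤ A`, so truncated subtraction is exact
-- here.
difference : ∀ {A B C} z .{{_ : NonZero z}} → A * z ≡ B * z + C →
             ∃ λ e → A ≡ B + e × e * z ≡ C
difference {A} {B} {C} z Az≡Bz+C = A ∸ B , sym (m+[n∸m]≡n B≤A) , (begin
  (A ∸ B) * z          ≡⟨ *-distribʳ-∸ z A B ⟩
  A * z ∸ B * z        ≡⟨ cong (_∸ B * z) Az≡Bz+C ⟩
  (B * z + C) ∸ B * z  ≡⟨ m+n∸m≡n (B * z) C ⟩
  C                    ∎)
  where
  open ≡-Reasoning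
  B≤A : B ≤ A
  B≤A = *-cancelʳ-≤ B A z (subst (B * z ≤_) (sym Az≡Bz+C) (m≤m+n (B * z) C))

-- If `p ≤ x`, all three denominators are at least `p`, so the right-hand side is at most `3xyz`,
-- which is less than `4xyz`.
smallest-denominator<p : ∀ {p x y z} .{{_ : NonZero x}} .{{_ : NonZero y}} .{{_ : NonZero z}} →
  x ≤ y → y ≤ z → 4 * x * y * z ≡ p * (x * y + (x + y) * z) → x < p
smallest-denominator<p {p} {x@(suc _)} {y@(suc _)} {z@(suc _)} x≤y y≤z eq = ≰⇒> λ p≤x →
  let p≤y = ≤-trans p≤x x≤y
      p≤z = ≤-trans p≤y y≤z
  in <-irrefl (sym eq) (begin-strict
    p * (x * y + (x + y) * z)                    ≡⟨ expand p x y z ⟩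
    p * (x * y) + (p * (x * z) + p * (y * z))    ≤⟨ +-mono-≤ (*-monoˡ-≤ (x * y) p≤z)
                                                     (+-mono-≤ (*-monoˡ-≤ (x * z) p≤y)
                                                               (*-monoˡ-≤ (y * z) p≤x)) ⟩
    z * (x * y) + (y * (x * z) + x * (y * z))    <⟨ m<m+n _ {x * y * z} (s≤s z≤n) ⟩
    z * (x * y) + (y * (x * z) + x * (y * z)) + x * y * z ≡⟨ collect x y z ⟩
    4 * x * y * z                                ∎)
  where
  open ≤-Reasoning
  expand : ∀ p x y z → p * (x * y + (x + y) * z) ≡ p * (x * y) + (p * (x * z) + p * (y * z))
  expand = solve-∀
  collect : ∀ x y z → z * (x * y) + (y * (x * z) + x * (y * z)) + x * y * z ≡ 4 * x * y * z
  collect = solve-∀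

prime∣4⇒≡2 : ∀ {p} → Prime p → p ∣ 4 → p ≡ 2
prime∣4⇒≡2 {p} pp p∣4 with irreducible[2] ([ (λ d → d) , (λ d → d) ]′ (euclidsLemma 2 2 pp p∣4))
... | inj₁ refl = contradiction refl (ℕ.nonTrivial⇒≢1 {{prime⇒nonTrivial pp}})
... | inj₂ p≡2 = p≡2

-- The solution 4/2 = 1/1 + 1/y + 1/y.
double-denominator≡2 : ∀ y .{{_ : NonZero y}} → 4 * 1 * y * y ≡ 2 * (1 * y + (1 + y) * y) → y ≡ 2
double-denominator≡2 y eq =
  +-cancelʳ-≡ y y 2 (*-cancelˡ-≡ (y + y) (2 + y) 2 (*-cancelʳ-≡ (2 * (y + y)) (2 * (2 + y)) y (begin
    2 * (y + y) * y           ≡⟨ solve (y ∷ []) ⟩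
    4 * 1 * y * y             ≡⟨ eq ⟩
    2 * (1 * y + (1 + y) * y) ≡⟨ solve (y ∷ []) ⟩
    2 * (2 + y) * y           ∎)))
  where open ≡-Reasoning

-- The value of `4a - pb` is `gcd y p`

module _ {p x y z a b g e : ℕ} (p-prime : Prime p)
         .{{_ : NonZero x}} .{{_ : NonZero y}} .{{_ : NonZero z}} .{{_ : NonZero g}}
         (y≤z : y ≤ z) (x<p : x < p)
         (eq : 4 * x * y * z ≡ p * (x * y + (x + y) * z))
         (xy≡ag : x * y ≡ a * g) (x+y≡bg : x + y ≡ b * g) (a⊥b : Coprime a b)
         (4a≡pb+e : 4 * a ≡ p * b + e) (ez≡pa : e * z ≡ p * a) where

  private
    instance
      p≢0 : NonZero p
      p≢0 = prime⇒nonZero p-prime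

    p∤x : p ∤ x
    p∤x = >⇒∤ x<p

  e≡1 : p ∤ y → e ≡ 1
  e≡1 p∤y = [ (λ e≡1 → e≡1) , (λ e≡p → contradiction e≡p e≢p) ]′ (prime⇒irreducible p-prime e∣p)
    where
    p∤a : p ∤ a
    p∤a p∣a = [ p∤x , p∤y ]′ (euclidsLemma x y p-prime (subst (p ∣_) (sym xy≡ag) (∣m⇒∣m*n g p∣a)))

    e⊥a : Coprime e a
    e⊥a = coprime-remainder 4 (∤⇒coprime p-prime p∤a) (Coprime.sym a⊥b) 4a≡pb+e

    e∣p : e ∣ p
    e∣p = coprime-divisor e⊥a (divides z (trans (*-comm a p) (trans (sym ez≡pa) (*-comm e z))))

    e≢p : ¬ e ≡ p
    e≢p refl = p∤y (∣-reflexive (trans p≡2 (sym y≡2)))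
      where
      -- With `e = p`, `4 * a` becomes `p * b + p`; as `p` does not divide `a`, it divides 4.
      p∣4a : p ∣ 4 * a
      p∣4a = subst (p ∣_) (sym 4a≡pb+e) (∣m∣n⇒∣m+n (m∣m*n b) ∣-refl)

      p≡2 : p ≡ 2
      p≡2 = [ prime∣4⇒≡2 p-prime , (λ p∣a → contradiction p∣a p∤a) ]′ (euclidsLemma 4 a p-prime p∣4a)

      x≡1 : x ≡ 1
      x≡1 = ≤-antisym (s≤s⁻¹ (subst (x <_) p≡2 x<p)) (ℕ.>-nonZero⁻¹ x)

      z≡a : z ≡ a
      z≡a = *-cancelˡ-≡ z a p ez≡pa

      -- Since `g` is at least 1 and `x = 1`, `z ≤ z * g = a * g = x * y = y`; hence `y = z`.
      z≤y : z ≤ y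
      z≤y = begin
        z      ≤⟨ m≤m*n z g ⟩
        z * g  ≡⟨ cong (_* g) z≡a ⟩
        a * g  ≡⟨ xy≡ag ⟨
        x * y  ≡⟨ cong (_* y) x≡1 ⟩
        1 * y  ≡⟨ *-identityˡ y ⟩
        y      ∎
        where open ≤-Reasoning

      y≡2 : y ≡ 2
      y≡2 = double-denominator≡2 y (specialise p≡2 x≡1 (≤-antisym z≤y y≤z) eq)
        where
        -- Fresh variables for `p`, `x` and `z` let the three equalities be matched with `refl`.
        specialise : ∀ {p x z} → p ≡ 2 → x ≡ 1 → z ≡ y →
                     4 * x * y * z ≡ p * (x * y + (x + y) * z) →
                     4 * 1 * y * y ≡ 2 * (1 * y + (1 + y) * y)
        specialise refl refl refl eq = eq

  e≡p : p ∣ y → e ≡ p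
  -- As `p` divides `x * y = a * g`, it divides `a` or `g`; the latter would make it divide `x + y`,
  -- and hence `x`.
  e≡p p∣y with [ (λ p∣a → p∣a) , (λ p∣g → contradiction (p∣g⇒p∣x p∣g) p∤x) ]′
                 (euclidsLemma a g p-prime (subst (p ∣_) xy≡ag (∣n⇒∣m*n x p∣y)))
    where
    p∣g⇒p∣x : p ∣ g → p ∣ x
    p∣g⇒p∣x p∣g =
      ∣m+n∣m⇒∣n (subst (p ∣_) (trans (sym x+y≡bg) (+-comm x y)) (∣n⇒∣m*n b p∣g)) p∣y
  ... | divides a′ refl
    -- Both `4 * a` and `p * b` are now multiples of `p`, hence so is `e`; it remains to show that
    -- the quotient `f` is 1.
    with ∣m+n∣m⇒∣n (subst (p ∣_) 4a≡pb+e (∣n⇒∣m*n 4 (n∣m*n a′))) (m∣m*n b)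
  ... | divides f refl =
    [ (λ f≡1 → trans (cong (_* p) f≡1) (*-identityˡ p)) , (λ f≡p → contradiction f≡p f≢p) ]′
      (prime⇒irreducible p-prime f∣p)
    where
    -- The factor 1 gives the shape `q * b + e` of `coprime-remainder`, with `q = 1` trivially
    -- coprime to `a′`.
    4a′≡b+f : 4 * a′ ≡ 1 * b + f
    4a′≡b+f = *-cancelʳ-≡ (4 * a′) (1 * b + f) p (begin
      4 * a′ * p      ≡⟨ *-assoc 4 a′ p ⟩
      4 * (a′ * p)    ≡⟨ 4a≡pb+e ⟩
      p * b + f * p   ≡⟨ solve (p ∷ b ∷ f ∷ []) ⟩
      (1 * b + f) * p ∎)
      where open ≡-Reasoning

    fz≡pa′ : f * z ≡ p * a′
    fz≡pa′ = *-cancelʳ-≡ (f * z) (p * a′) p (begin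
      f * z * p    ≡⟨ solve (f ∷ z ∷ p ∷ []) ⟩
      f * p * z    ≡⟨ ez≡pa ⟩
      p * (a′ * p) ≡⟨ *-assoc p a′ p ⟨
      p * a′ * p   ∎)
      where open ≡-Reasoning

    b⊥a′ : Coprime b a′
    b⊥a′ (d∣b , d∣a′) = a⊥b (∣m⇒∣m*n p d∣a′ , d∣b)

    f∣p : f ∣ p
    f∣p = coprime-divisor (coprime-remainder 4 (λ (d∣1 , _) → ∣1⇒≡1 d∣1) b⊥a′ 4a′≡b+f)
            (divides z (trans (*-comm a′ p) (trans (sym fz≡pa′) (*-comm f z))))

    -- With `f = p`, cancelling `p` gives `z = a′`, so `p * y ≤ p * z ≤ z * p * g = x * y` and
    -- `p ≤ x`.
    f≢p : ¬ f ≡ p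
    f≢p refl = <⇒≱ x<p (*-cancelʳ-≤ p x y (begin
      p * y      ≤⟨ *-monoʳ-≤ p y≤z ⟩
      p * z      ≡⟨ *-comm p z ⟩
      z * p      ≤⟨ m≤m*n (z * p) g ⟩
      z * p * g  ≡⟨ cong (λ t → t * p * g) (*-cancelˡ-≡ z a′ p fz≡pa′) ⟩
      a′ * p * g ≡⟨ xy≡ag ⟨
      x * y      ∎))
      where open ≤-Reasoning

  e≡gcd : e ≡ gcd y p
  e≡gcd with p ∣? y
  ... | yes p∣y = trans (e≡p p∣y) (∣-antisym (gcd-greatest p∣y ∣-refl) (gcd[m,n]∣n y p))
  ... | no p∤y  = trans (e≡1 p∤y) (sym (coprime⇒gcd≡1 (Coprime.sym (∤⇒coprime p-prime p∤y))))

-- The identity over the naturals, without subtraction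

4xy≡[x+y]p+gcd*gcd : ∀ {p} x y z .{{_ : NonZero x}} .{{_ : NonZero y}} .{{_ : NonZero z}} →
  Prime p → x ≤ y → y ≤ z → 4 * x * y * z ≡ p * (x * y + (x + y) * z) →
  4 * x * y ≡ (x + y) * p + gcd y p * gcd (x * y) (x + y)
4xy≡[x+y]p+gcd*gcd {p} x y z p-prime x≤y y≤z eq = begin
  4 * x * y                ≡⟨ *-assoc 4 x y ⟩
  4 * (x * y)              ≡⟨ cong (4 *_) xy≡ag ⟩
  4 * (a * g)              ≡⟨ *-assoc 4 a g ⟨
  4 * a * g                ≡⟨ cong (_* g) 4a≡pb+e ⟩
  (p * b + e) * g          ≡⟨ regroup p b e g ⟩
  b * g * p + e * g        ≡⟨ cong₂ (λ s t → s * p + t * g) (sym x+y≡bg)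
                                (e≡gcd p-prime y≤z (smallest-denominator<p x≤y y≤z eq)
                                       eq xy≡ag x+y≡bg a⊥b 4a≡pb+e ez≡pa) ⟩
  (x + y) * p + gcd y p * g ∎
  where
  open ≡-Reasoning
  g = gcd (x * y) (x + y)

  instance
    g≢0 : NonZero g
    g≢0 = ≢-nonZero (gcd[m,n]≢0 (x * y) (x + y)
            (inj₁ (≢-nonZero⁻¹ (x * y) {{m*n≢0 x y}})))

  a = (x * y) /ₙ g
  b = (x + y) /ₙ g

  a⊥b : Coprime a b
  a⊥b = coprime-/gcd (x * y) (x + y)

  xy≡ag : x * y ≡ a * g
  xy≡ag = sym (m/n*n≡m (gcd[m,n]∣m (x * y) (x + y)))

  x+y≡bg : x + y ≡ b * g
  x+y≡bg = sym (m/n*n≡m (gcd[m,n]∣n (x * y) (x + y)))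

  regroup : ∀ p b e g → (p * b + e) * g ≡ b * g * p + e * g
  regroup = solve-∀

  pull : ∀ a z g → 4 * a * z * g ≡ 4 * (a * g) * z
  pull = solve-∀

  push : ∀ p a b z g → p * (a * g + b * g * z) ≡ (p * b * z + p * a) * g
  push = solve-∀

  -- Both sides of `eq` are multiples of `g`, which is cancelled; `difference` then produces `e`.
  reduced : 4 * a * z ≡ p * b * z + p * a
  reduced = *-cancelʳ-≡ (4 * a * z) (p * b * z + p * a) g (begin
    4 * a * z * g               ≡⟨ pull a z g ⟩
    4 * (a * g) * z             ≡⟨ cong (λ t → 4 * t * z) xy≡ag ⟨
    4 * (x * y) * z             ≡⟨ cong (_* z) (*-assoc 4 x y) ⟨
    4 * x * y * z               ≡⟨ eq ⟩
    p * (x * y + (x + y) * z)   ≡⟨ cong₂ (λ s t → p * (s + t * z)) xy≡ag x+y≡bg ⟩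
    p * (a * g + b * g * z)     ≡⟨ push p a b z g ⟩
    (p * b * z + p * a) * g     ∎)

  excess : ∃ λ e → 4 * a ≡ p * b + e × e * z ≡ p * a
  excess = difference {4 * a} {p * b} z reduced

  e = proj₁ excess
  4a≡pb+e = proj₁ (proj₂ excess)
  ez≡pa = proj₂ (proj₂ excess)

-- Transfer from rationals and to integers

clear-denominators : ∀ p x y z .{{_ : NonZero p}} .{{_ : NonZero x}} .{{_ : NonZero y}} .{{_ : NonZero z}} →
  + 4 / p ≡ ((+ 1 / x) ℚ.+ (+ 1 / y)) ℚ.+ (+ 1 / z) →
  4 * x * y * z ≡ p * (x * y + (x + y) * z)
clear-denominators p@(suc p′) x@(suc x′) y@(suc y′) z@(suc z′) eq with unnormalised
  where
  open ℚᵘ.≃-Reasoning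
  -- Normalised fractions hide their denominators behind a gcd; for unnormalised ones equality is
  -- cross-multiplication.
  unnormalised : (+ 4 ℚᵘ./ p) ℚᵘ.≃ ((+ 1 ℚᵘ./ x) ℚᵘ.+ (+ 1 ℚᵘ./ y)) ℚᵘ.+ (+ 1 ℚᵘ./ z)
  unnormalised = begin
    + 4 ℚᵘ./ p
      ≈⟨ ℚ.toℚᵘ-fromℚᵘ (ℚᵘ.mkℚᵘ (+ 4) p′) ⟨
    ℚ.toℚᵘ (+ 4 / p)
      ≈⟨ ℚ.toℚᵘ-cong eq ⟩
    ℚ.toℚᵘ (((+ 1 / x) ℚ.+ (+ 1 / y)) ℚ.+ (+ 1 / z))
      ≈⟨ ℚ.toℚᵘ-homo-+ ((+ 1 / x) ℚ.+ (+ 1 / y)) (+ 1 / z) ⟩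
    ℚ.toℚᵘ ((+ 1 / x) ℚ.+ (+ 1 / y)) ℚᵘ.+ ℚ.toℚᵘ (+ 1 / z)
      ≈⟨ ℚᵘ.+-congˡ (ℚ.toℚᵘ (+ 1 / z)) (ℚ.toℚᵘ-homo-+ (+ 1 / x) (+ 1 / y)) ⟩
    (ℚ.toℚᵘ (+ 1 / x) ℚᵘ.+ ℚ.toℚᵘ (+ 1 / y)) ℚᵘ.+ ℚ.toℚᵘ (+ 1 / z)
      ≈⟨ ℚᵘ.+-cong (ℚᵘ.+-cong (ℚ.toℚᵘ-fromℚᵘ (ℚᵘ.mkℚᵘ (+ 1) x′)) (ℚ.toℚᵘ-fromℚᵘ (ℚᵘ.mkℚᵘ (+ 1) y′)))
                   (ℚ.toℚᵘ-fromℚᵘ (ℚᵘ.mkℚᵘ (+ 1) z′)) ⟩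
    ((+ 1 ℚᵘ./ x) ℚᵘ.+ (+ 1 ℚᵘ./ y)) ℚᵘ.+ (+ 1 ℚᵘ./ z) ∎
... | ℚᵘ.*≡* eqℤ = begin
  4 * x * y * z                                ≡⟨ lhs x y z ⟩
  -- With denominators exposed as successors, both sides of `eqℤ` compute to `+` of a natural
  -- number.
  4 * (x * y * z)                              ≡⟨ ℤ.+-injective eqℤ ⟩
  ((1 * y + 1 * x) * z + 1 * (x * y)) * p      ≡⟨ rhs p x y z ⟩
  p * (x * y + (x + y) * z)                    ∎
  where
  open ≡-Reasoning
  lhs : ∀ x y z → 4 * x * y * z ≡ 4 * (x * y * z)
  lhs = solve-∀
  rhs : ∀ p x y z → ((1 * y + 1 * x) * z + 1 * (x * y)) * p ≡ p * (x * y + (x + y) * z)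
  rhs = solve-∀

m≡n+o⇒m-n≡o : ∀ {m} n {o} → m ≡ n + o → + m ℤ.- + n ≡ + o
m≡n+o⇒m-n≡o n {o} refl = begin
  + (n + o) ℤ.- + n ≡⟨ ℤ.[+m]-[+n]≡m⊖n (n + o) n ⟩
  (n + o) ℤ.⊖ n     ≡⟨ ℤ.⊖-≥ (m≤m+n n o) ⟩
  + (n + o ∸ n)     ≡⟨ cong +_ (m+n∸m≡n n o) ⟩
  + o               ∎
  where open ≡-Reasoning

theorem1 : ∀ (p : ℕ) (p-prime : Prime p)
    (x y z : ℕ) .{{_ : NonZero x}} .{{_ : NonZero y}} .{{_ : NonZero z}} →
    x ℕ.≤ y → y ℕ.≤ z →
    (_/_ (+ 4) p {{prime⇒nonZero p-prime}}) ≡ ((+ 1 / x) ℚ.+ (+ 1 / y)) ℚ.+ (+ 1 / z) →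
    (((+ 4 ℤ.* + x) ℤ.* + y) ℤ.- ((+ x ℤ.+ + y) ℤ.* + p)) ≡ + (gcd y p ℕ.* gcd (x ℕ.* y) (x ℕ.+ y))
theorem1 p p-prime x y z x≤y y≤z eq = begin
  + 4 ℤ.* + x ℤ.* + y ℤ.- (+ x ℤ.+ + y) ℤ.* + p
    ≡⟨ cong₂ ℤ._-_ (trans (ℤ.pos-* (4 * x) y) (cong (ℤ._* + y) (ℤ.pos-* 4 x))) (ℤ.pos-* (x + y) p) ⟨
  + (4 * x * y) ℤ.- + ((x + y) * p)
    ≡⟨ m≡n+o⇒m-n≡o ((x + y) * p) (4xy≡[x+y]p+gcd*gcd x y z p-prime x≤y y≤z
         (clear-denominators p x y z {{prime⇒nonZero p-prime}} eq)) ⟩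
  + (gcd y p * gcd (x * y) (x + y)) ∎
  where open ≡-Reasoning
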